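{- Let $G$ and $H$ be connected graphs of order at least $2$. Then $${\rm gp}(H)\le \underline{{\rm gp}}_{\rm S}(G,H)\le {\rm gp}_{\rm S}(G,H)\le n(G)\,{\rm gp}(H).$$ Moreover, ${\rm gp}_{\rm S}(G,H)=n(G)\,{\rm gp}(H)$ if and only if ${\rm gp}(H)=\xi(H)$.
   Context: All graphs are finite, simple and connected; $n(G)=|V(G)|$. For vertices $x,y$, $d(x,y)$ is the distance and $I_H[x,y]=\{w: d_H(x,y)=d_H(x,w)+d_H(w,y)\}$. A set $X$ of vertices is a general position set if no shortest path contains more than two vertices of $X$; ${\rm gp}$ denotes the maximum cardinality of a general position set. For $u\in V(H)$, a set $S\subseteq V(H)$ is $u$-colinear if $S$ is a general position set of $H$, $u\notin S$, and $y\notin I_H[x,u]$ for all distinct $x,y\in S$; $\xi_H(u)$ is the maximum cardinality of a $u$-colinear set and $\xi(H)=\max_{u\in V(H)}\xi_H(u)$. For $f\colon V(G)\to V(H)$, the Sierpiński product $G\otimes_f H$ has vertex set $V(G)\times V(H)$ and edges $(g,h)(g,h')$ for $g\in V(G)$, $hh'\in E(H)$, and $(g,f(g'))(g',f(g))$ for $gg'\in E(G)$. Writing $H^G$ for the set of all functions $V(G)\to V(H)$, ${\rm gp}_{\rm S}(G,H)=\max_{f\in H^G}{\rm gp}(G\otimes_f H)$ and $\underline{{\rm gp}}_{\rm S}(G,H)=\min_{f\in H^G}{\rm gp}(G\otimes_f H)$. -}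

module Defs where

open import Data.Nat using (ℕ; zero; suc; _+_; _≤_)
open import Data.Fin using (Fin)
open import Data.Product using (Σ; ∃; ∃-syntax; _×_; _,_)
open import Data.Sum using (_⊎_; inj₁; inj₂)
open import Data.List using (List; []; _∷_; length)
open import Data.List.Membership.Propositional using (_∈_; _∉_)
open import Data.List.Relation.Unary.Unique.Propositional using (Unique)
open import Relation.Nullary using (¬_)
open import Relation.Binary.PropositionalEquality using (_≡_; _≢_; refl; sym)

record Graph (V : Set) : Set₁ where
  field
    Adj    : V → V → Set
    adjSym : ∀ {x y} → Adj x y → Adj y x
    irrefl : ∀ {x} → ¬ Adj x x
open Graph public

data Walk {V : Set} (G : Graph V) : V → V → ℕ → Set where
  []  : ∀ {x} → Walk G x x 0
  _∷_ : ∀ {x y z k} → Adj G x y → Walk G y z k → Walk G x z (suc k)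

verts : ∀ {V : Set} {G : Graph V} {x y k} → Walk G x y k → List V
verts ([] {x}) = x ∷ []
verts (_∷_ {x} e w) = x ∷ verts w

Connected : ∀ {V : Set} → Graph V → Set
Connected {V} G = (x y : V) → ∃[ k ] Walk G x y k

Dist : ∀ {V : Set} → Graph V → V → V → ℕ → Set
Dist G x y k = Walk G x y k × (∀ m → Walk G x y m → k ≤ m)

InInterval : ∀ {V : Set} → Graph V → V → V → V → Set
InInterval G x y w =
  ∃[ a ] ∃[ b ] ∃[ c ] (Dist G x y a × Dist G x w b × Dist G w y c × a ≡ b + c)

IsGPSet : ∀ {V : Set} → Graph V → List V → Set
IsGPSet {V} G X =
  Unique X ×
  (∀ {x y k} (w : Walk G x y k) → Dist G x y k →
     ¬ (Σ V λ p → Σ V λ q → Σ V λ r →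
          p ≢ q × p ≢ r × q ≢ r ×
          p ∈ X × q ∈ X × r ∈ X ×
          p ∈ verts w × q ∈ verts w × r ∈ verts w))

IsMaxOf : (ℕ → Set) → ℕ → Set
IsMaxOf P m = P m × (∀ k → P k → k ≤ m)

IsMinOf : (ℕ → Set) → ℕ → Set
IsMinOf P m = P m × (∀ k → P k → m ≤ k)

IsGp : ∀ {V : Set} → Graph V → ℕ → Set
IsGp G = IsMaxOf (λ k → ∃[ X ] (IsGPSet G X × length X ≡ k))

IsColinear : ∀ {V : Set} → Graph V → V → List V → Set
IsColinear G u S =
  IsGPSet G S × u ∉ S ×
  (∀ x y → x ∈ S → y ∈ S → x ≢ y → ¬ InInterval G x u y)

IsXiAt : ∀ {V : Set} → Graph V → V → ℕ → Set
IsXiAt H u = IsMaxOf (λ k → ∃[ S ] (IsColinear H u S × length S ≡ k))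

IsXi : ∀ {V : Set} → Graph V → ℕ → Set
IsXi {V} H = IsMaxOf (λ k → Σ V λ u → IsXiAt H u k)

SierAdj : ∀ {VG VH : Set} → Graph VG → Graph VH → (VG → VH) →
          VG × VH → VG × VH → Set
SierAdj G H f (g , h) (g' , h') =
  (g ≡ g' × Adj H h h') ⊎ (Adj G g g' × h ≡ f g' × h' ≡ f g)

Sier : ∀ {VG VH : Set} → Graph VG → Graph VH → (VG → VH) → Graph (VG × VH)
Sier G H f = record { Adj = SierAdj G H f ; adjSym = s ; irrefl = i }
  where
  s : ∀ {x y} → SierAdj G H f x y → SierAdj G H f y x
  s (inj₁ (refl , a)) = inj₁ (refl , adjSym H a)
  s (inj₂ (a , p , q)) = inj₂ (adjSym G a , q , p)
  i : ∀ {x} → ¬ SierAdj G H f x x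
  i (inj₁ (_ , a)) = irrefl H a
  i (inj₂ (a , _ , _)) = irrefl G a

IsGpS : ∀ {VG VH : Set} → Graph VG → Graph VH → ℕ → Set
IsGpS {VG} {VH} G H = IsMaxOf (λ k → Σ (VG → VH) λ f → IsGp (Sier G H f) k)

IsGpSLow : ∀ {VG VH : Set} → Graph VG → Graph VH → ℕ → Set
IsGpSLow {VG} {VH} G H = IsMinOf (λ k → Σ (VG → VH) λ f → IsGp (Sier G H f) k)

{-# OPTIONS --safe #-}
-- Along an edge of G ⊗_f H the unordered pair {h, f g} attached to (g , h) either
-- has one entry moved along an edge of H or, at an edge joining two fibres, is left
-- unchanged.  Hence fibres are isometric copies of H, which gives the three
-- inequalities by counting a general position set fibrewise.
--
-- If S is u-colinear of size gp(H), then V(G) × S is in general position for the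
-- constant f = u.  Conversely, if X attains n(G) gp(H), then all fibres of X have
-- gp(H) points.  Fix (g₀ , z) ∈ X and a neighbour g of g₀ that minimises
-- d(f g , z) − d(f g , f g₀).  Comparing the last entries into the fibre of g₀
-- shows that for each x some shortest path from (g , x) to (g₀ , z) uses the edge
-- between the two fibres directly, so the fibre X_g is f(g₀)-colinear.
module Submission where

open import Defs
open import Data.Bool.Base using (if_then_else_; true; false)
open import Data.Empty using (⊥)
open import Data.Nat
  using (ℕ; zero; suc; _+_; _*_; _∸_; _≤_; _<_; z≤n; s≤s)
open import Data.Nat.Properties
open import Data.Nat.Induction using (<-rec)
open import Data.Nat.Tactic.RingSolver using (solve-∀)
open import Data.Fin using (Fin; zero; suc; punchIn)
import Data.Fin.Properties as Fin
open import Data.Product using (Σ; ∃; ∃-syntax; ∃₂; _×_; _,_; proj₁; proj₂)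
open import Data.Product.Properties using (,-injectiveˡ; ,-injectiveʳ)
open import Data.Sum using (_⊎_; inj₁; inj₂)
open import Data.List
  using (List; []; _∷_; _++_; length; map; filter; allFin; cartesianProduct)
open import Data.List.Properties using (++-identityʳ; length-map; length-++; length-tabulate)
open import Data.List.Membership.Propositional using (_∈_; _∉_)
open import Data.List.Membership.Propositional.Properties
  using (∈-map⁻; ∈-filter⁻; ∈-cartesianProduct⁻)
open import Data.List.Relation.Unary.Any using (here; there)
open import Data.List.Relation.Unary.All as All using (All; []; _∷_)
open import Data.List.Relation.Unary.AllPairs using ([]; _∷_)
open import Data.List.Relation.Unary.Unique.Propositional using (Unique)
import Data.List.Relation.Unary.Unique.Propositional.Properties as Unique
open import Data.List.Relation.Binary.Permutation.Propositional
  using (_↭_; ↭-refl; ↭-sym; ↭-trans; ↭⇒↭ₛ; prep)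
open import Data.List.Relation.Binary.Permutation.Propositional.Properties
  using (All-resp-↭; ↭-length; shift; ++⁺ˡ)
import Data.List.Relation.Binary.Permutation.Setoid.Properties as Permutation
open import Algebra.Properties.CommutativeMonoid.Sum +-0-commutativeMonoid
  using (sum; sum-remove; sum-cong-≗; sum-replicate-zero; ∑-distrib-+)
open import Data.Vec.Functional using (removeAt)
open import Effect.Monad using (RawMonad)
open import Function.Base using (_∘_)
open import Function.Bundles using (_⇔_; mk⇔)
open import Relation.Nullary using (¬_; Dec; yes; no; does; contradiction)
open import Relation.Nullary.Decidable using (decidable-stable)
open import Relation.Nullary.Negation using (¬¬-Monad)
open import Relation.Binary.PropositionalEquality
  using (_≡_; _≢_; refl; sym; trans; cong; cong₂; subst; setoid; module ≡-Reasoning)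

-- Minimisers and finite choice under double negation

-- Adjacency carries no decision procedure, so a minimiser is available only under double negation.
-- Well-founded recursion on the value of `φ` refutes its absence.
¬¬-argmin : ∀ {A : Set} (P : A → Set) (φ : A → ℕ) {a} → P a →
            ¬ ¬ (∃[ m ] P m × (∀ b → P b → φ m ≤ φ b))
¬¬-argmin {A} P φ {a} pa noMin = <-rec (λ n → ∀ b → P b → φ b ≡ n → ⊥) step (φ a) a pa refl
  where
  step : ∀ n → (∀ {m} → m < n → ∀ b → P b → φ b ≡ m → ⊥) → ∀ b → P b → φ b ≡ n → ⊥
  step _ rec b pb refl = noMin (b , pb , λ c pc → ≮⇒≥ λ c<b → rec c<b c pc refl)

¬¬-distances : ∀ {n} (H : Graph (Fin n)) → Connected H →
               ¬ ¬ (∀ x y → ∃ (Dist H x y))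
-- Finiteness of the vertex set moves both double negations outside the quantifiers.
¬¬-distances H conn = choice λ x → choice λ y → ¬¬-argmin (Walk H x y) (λ k → k) (proj₂ (conn x y))
  where
  choice : ∀ {n} {P : Fin n → Set} → (∀ i → ¬ ¬ P i) → ¬ ¬ (∀ i → P i)
  choice = Fin.sequence (RawMonad.rawApplicative ¬¬-Monad)

-- Walks, intervals and general position

module _ {V : Set} {G : Graph V} where

  infixr 5 _++ʷ_
  _++ʷ_ : ∀ {x y z i j} → Walk G x y i → Walk G y z j → Walk G x z (i + j)
  []      ++ʷ w′ = w′
  (e ∷ w) ++ʷ w′ = e ∷ (w ++ʷ w′)

  reverseʷ : ∀ {x y k} → Walk G x y k → Walk G y x k
  reverseʷ []                = []
  reverseʷ (_∷_ {k = k} e w) =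
    subst (Walk G _ _) (+-comm k 1) (reverseʷ w ++ʷ (adjSym G e ∷ []))

  start∈verts : ∀ {x y k} (w : Walk G x y k) → x ∈ verts w
  start∈verts []      = here refl
  start∈verts (e ∷ w) = here refl

  ∈-++ʷ⁺ʳ : ∀ {x y z p i j} (w : Walk G x y i) (w′ : Walk G y z j) →
            p ∈ verts w′ → p ∈ verts (w ++ʷ w′)
  ∈-++ʷ⁺ʳ []      w′ p∈ = p∈
  ∈-++ʷ⁺ʳ (e ∷ w) w′ p∈ = there (∈-++ʷ⁺ʳ w w′ p∈)

  end∈verts : ∀ {x y k} (w : Walk G x y k) → y ∈ verts w
  end∈verts []      = here refl
  end∈verts (e ∷ w) = there (end∈verts w)

  Dist-sym : ∀ {x y k} → Dist G x y k → Dist G y x k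
  Dist-sym (w , min) = reverseʷ w , λ m w′ → min m (reverseʷ w′)

  InInterval-sym : ∀ {x y w} → InInterval G x y w → InInterval G y x w
  InInterval-sym (_ , b , c , xy , xw , wy , a≡b+c) =
    _ , c , b , Dist-sym xy , Dist-sym wy , Dist-sym xw , trans a≡b+c (+-comm b c)

  geodesic⇒InInterval : ∀ {x y z b c} → Walk G x y b → Walk G y z c →
                        (∀ m → Walk G x z m → b + c ≤ m) → InInterval G x z y
  geodesic⇒InInterval {b = b} {c} w w′ min =
    b + c , b , c , (w ++ʷ w′ , min) ,
    (w  , λ m v → +-cancelʳ-≤ c b m (min (m + c) (v ++ʷ w′))) ,
    (w′ , λ m v → +-cancelˡ-≤ b c m (min (b + m) (w ++ʷ v))) , refl

  IsGPSet⇒¬InInterval : ∀ {X} → IsGPSet G X → ∀ {p q r} → p ∈ X → q ∈ X → r ∈ X →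
                        p ≢ q → p ≢ r → q ≢ r → ¬ InInterval G p r q
  IsGPSet⇒¬InInterval (_ , gp) p∈ q∈ r∈ p≢q p≢r q≢r
    (_ , _ , _ , (_ , min) , (w , _) , (w′ , _) , refl) =
    gp (w ++ʷ w′) (w ++ʷ w′ , min)
       (_ , _ , _ , p≢q , p≢r , q≢r , p∈ , q∈ , r∈ ,
        start∈verts (w ++ʷ w′) , ∈-++ʷ⁺ʳ w w′ (start∈verts w′) , end∈verts (w ++ʷ w′))

  -- A walk with marked stops in order of visit. Segments may be empty, so a vertex may be listed
  -- repeatedly.
  data Through : V → List V → V → ℕ → Set where
    end : ∀ {x y k} → Walk G x y k → Through x [] y k
    via : ∀ {x p y ps i j} → Walk G x p i → Through p ps y j → Through x (p ∷ ps) y (i + j)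

  through-cons : ∀ {x y z ps k} → Adj G x y → Through y ps z k → Through x ps z (suc k)
  through-cons e (end w)   = end (e ∷ w)
  through-cons e (via w t) = via (e ∷ w) t

  through-prepend : ∀ {x y ps qs k} → All (x ≡_) ps → Through x qs y k → Through x (ps ++ qs) y k
  through-prepend []           t = t
  through-prepend (refl ∷ eqs) t = via [] (through-prepend eqs t)

  split-∈-∷ : ∀ {x : V} {vs L} → All (_∈ x ∷ vs) L →
              ∃₂ λ ps qs → L ↭ ps ++ qs × All (x ≡_) ps × All (_∈ vs) qs
  split-∈-∷ [] = [] , [] , ↭-refl , [] , []
  split-∈-∷ (l∈ ∷ L∈) with split-∈-∷ L∈
  split-∈-∷ (here refl ∷ L∈) | ps , qs , L↭ , ps≡ , qs∈ =
    _ ∷ ps , qs , prep _ L↭ , refl ∷ ps≡ , qs∈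
  split-∈-∷ (there l∈ ∷ L∈) | ps , qs , L↭ , ps≡ , qs∈ =
    ps , _ ∷ qs , ↭-trans (prep _ L↭) (↭-sym (shift _ ps qs)) , ps≡ , l∈ ∷ qs∈

  -- Stops equal to the start of the walk are moved to the front; the others lie on the rest of the
  -- walk. Three points on a geodesic thus need no split into six orders.
  order-along : ∀ {x y k L} (w : Walk G x y k) → All (_∈ verts w) L →
                ∃[ L′ ] L ↭ L′ × Through x L′ y k
  order-along {L = L} [] L∈ =
    L ++ [] , subst (L ↭_) (sym (++-identityʳ L)) ↭-refl ,
    through-prepend (All.map (λ { (here refl) → refl }) L∈) (end [])
  order-along (e ∷ w) L∈ with split-∈-∷ L∈
  ... | ps , qs , L↭ , ps≡ , qs∈ with order-along w qs∈
  ... | qs′ , qs↭ , t =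
    ps ++ qs′ , ↭-trans L↭ (++⁺ˡ ps qs↭) , through-prepend ps≡ (through-cons e t)

  -- With `IsGPSet⇒¬InInterval` this replaces geodesics by betweenness of triples. A geodesic meets
  -- three points in some order, and its segment from the first to the third is again a geodesic.
  ¬InInterval⇒IsGPSet : ∀ {X} → Unique X →
    (∀ {p q r} → p ∈ X → q ∈ X → r ∈ X → p ≢ q → p ≢ r → q ≢ r → ¬ InInterval G p r q) →
    IsGPSet G X
  ¬InInterval⇒IsGPSet {X} unique separated = unique , gp
    where
    ordered : ∀ {x y k L} → Dist G x y k → Through x L y k → length L ≡ 3 →
              Unique L → ¬ All (_∈ X) L
    ordered (_ , min) (via {i = i} u (via {i = j} v (via {i = l} w (end {k = m} t)))) refl
      ((p≢q ∷ p≢r ∷ []) ∷ (q≢r ∷ []) ∷ [] ∷ []) (p∈ ∷ q∈ ∷ r∈ ∷ []) =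
      separated p∈ q∈ r∈ p≢q p≢r q≢r (geodesic⇒InInterval v w λ n s →
        -- A shorter walk `s` from `p` to `r` would shorten the whole geodesic; `i` and `m` are the
        -- lengths before `p` and after `r`.
        +-cancelʳ-≤ m (j + l) n (+-cancelˡ-≤ i (j + l + m) (n + m)
          (subst (λ k → i + k ≤ i + (n + m)) (sym (+-assoc j l m)) (min _ (u ++ʷ s ++ʷ t)))))

    gp : ∀ {x y k} (w : Walk G x y k) → Dist G x y k → _
    gp w d (p , q , r , p≢q , p≢r , q≢r , p∈X , q∈X , r∈X , p∈ , q∈ , r∈)
      with order-along w (p∈ ∷ q∈ ∷ r∈ ∷ [])
    ... | L , ↭L , t =
      ordered d t (sym (↭-length ↭L))
        (Permutation.Unique-resp-↭ (setoid V) (↭⇒↭ₛ ↭L)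
          ((p≢q ∷ p≢r ∷ []) ∷ (q≢r ∷ []) ∷ [] ∷ []))
        (All-resp-↭ ↭L (p∈X ∷ q∈X ∷ r∈X ∷ []))

  pair-IsGPSet : ∀ {x y} → x ≢ y → IsGPSet G (x ∷ y ∷ [])
  pair-IsGPSet x≢y = ¬InInterval⇒IsGPSet ((x≢y ∷ []) ∷ [] ∷ []) λ
    { (here refl)         (here refl)         _                   p≢q _   _   _ → p≢q refl
    ; (here refl)         (there (here refl)) (here refl)         _   p≢r _   _ → p≢r refl
    ; (here refl)         (there (here refl)) (there (here refl)) _   _   q≢r _ → q≢r refl
    ; (there (here refl)) (here refl)         (here refl)         _   _   q≢r _ → q≢r refl
    ; (there (here refl)) (here refl)         (there (here refl)) _   p≢r _   _ → p≢r refl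
    ; (there (here refl)) (there (here refl)) _                   p≢q _   _   _ → p≢q refl }

-- Sierpiński products

module _ {VG VH : Set} {G : Graph VG} {H : Graph VH} {f : VG → VH} where

  fibreʷ : ∀ {g h h′ k} → Walk H h h′ k → Walk (Sier G H f) (g , h) (g , h′) k
  fibreʷ []      = []
  fibreʷ (e ∷ w) = inj₁ (refl , e) ∷ fibreʷ w

  -- An edge between fibres exchanges the roles of the two entries, so the first alternative arises
  -- from an even number of such edges and the second from an odd number. Each of them costs 1
  -- without moving an entry, hence only `≤ k`.
  pair-walks : ∀ {g h g′ h′ k} → Walk (Sier G H f) (g , h) (g′ , h′) k →
    (∃₂ λ i j → Walk H h h′ i     × Walk H (f g) (f g′) j × i + j ≤ k) ⊎
    (∃₂ λ i j → Walk H h (f g′) i × Walk H (f g) h′ j     × i + j ≤ k)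
  pair-walks [] = inj₁ (0 , 0 , [] , [] , z≤n)
  pair-walks (inj₁ (refl , e) ∷ w) with pair-walks w
  ... | inj₁ (i , j , u , v , le) = inj₁ (suc i , j , e ∷ u , v , s≤s le)
  ... | inj₂ (i , j , u , v , le) = inj₂ (suc i , j , e ∷ u , v , s≤s le)
  pair-walks (inj₂ (_ , refl , refl) ∷ w) with pair-walks w
  ... | inj₁ (i , j , u , v , le) =
    inj₂ (j , i , v , u , m≤n⇒m≤1+n (≤-trans (≤-reflexive (+-comm j i)) le))
  ... | inj₂ (i , j , u , v , le) =
    inj₁ (j , i , v , u , m≤n⇒m≤1+n (≤-trans (≤-reflexive (+-comm j i)) le))

  project : ∀ {g h h′ k} → Walk (Sier G H f) (g , h) (g , h′) k →
            ∃[ m ] Walk H h h′ m × m ≤ k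
  project w with pair-walks w
  ... | inj₁ (i , j , u , v , le) = i , u , ≤-trans (m≤m+n i j) le
  -- Both ends lie over `g`, so the two crossed walks meet at `f g` and can be joined.
  ... | inj₂ (i , j , u , v , le) = i + j , u ++ʷ v , le

  Dist-fibre⁺ : ∀ {g h h′ k} → Dist H h h′ k → Dist (Sier G H f) (g , h) (g , h′) k
  Dist-fibre⁺ (w , min) = fibreʷ w , λ m v →
    let (n , u , n≤m) = project v in ≤-trans (min n u) n≤m

  Dist-fibre⁻ : ∀ {g h h′ k} → Dist (Sier G H f) (g , h) (g , h′) k → Dist H h h′ k
  Dist-fibre⁻ (w , min) =
    let (n , u , n≤k) = project w
    in subst (Walk H _ _) (≤-antisym n≤k (min n (fibreʷ u))) u , λ m v → min m (fibreʷ v)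

  InInterval-fibre⁺ : ∀ {g x y w} → InInterval H x y w →
                      InInterval (Sier G H f) (g , x) (g , y) (g , w)
  InInterval-fibre⁺ (a , b , c , xy , xw , wy , eq) =
    a , b , c , Dist-fibre⁺ xy , Dist-fibre⁺ xw , Dist-fibre⁺ wy , eq

  InInterval-fibre⁻ : ∀ {g x y w} → InInterval (Sier G H f) (g , x) (g , y) (g , w) →
                      InInterval H x y w
  InInterval-fibre⁻ (a , b , c , xy , xw , wy , eq) =
    a , b , c , Dist-fibre⁻ xy , Dist-fibre⁻ xw , Dist-fibre⁻ wy , eq

  -- The cut is made at the last edge into the fibre of `g₀`, which runs from `(g′ , f g₀)` to
  -- `(g₀ , f g′)`; what follows stays in that fibre.
  last-entry : ∀ {g h g₀ z k} → Walk (Sier G H f) (g , h) (g₀ , z) k →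
    (g ≡ g₀ × Walk H h z k) ⊎
    (Σ VG λ g′ → ∃₂ λ i j → Adj G g₀ g′ × Walk (Sier G H f) (g , h) (g′ , f g₀) i ×
                            Walk H (f g′) z j × suc (i + j) ≡ k)
  last-entry [] = inj₁ (refl , [])
  last-entry (e ∷ w) with last-entry w
  last-entry (inj₁ (refl , e) ∷ w) | inj₁ (refl , v) = inj₁ (refl , e ∷ v)
  last-entry (inj₂ (e , refl , refl) ∷ w) | inj₁ (refl , v) =
    inj₂ (_ , 0 , _ , adjSym G e , [] , v , refl)
  last-entry (e ∷ w) | inj₂ (g′ , i , j , a , u , v , eq) =
    inj₂ (g′ , suc i , j , a , e ∷ u , v , cong suc eq)

  lift-IsGPSet : ∀ g {X} → IsGPSet H X → IsGPSet (Sier G H f) (map (g ,_) X)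
  lift-IsGPSet g {X} gpX = ¬InInterval⇒IsGPSet (Unique.map⁺ ,-injectiveʳ (proj₁ gpX)) separated
    where
    separated : ∀ {p q r} → p ∈ map (g ,_) X → q ∈ map (g ,_) X → r ∈ map (g ,_) X →
                p ≢ q → p ≢ r → q ≢ r → ¬ InInterval (Sier G H f) p r q
    separated p∈ q∈ r∈ p≢q p≢r q≢r between
      with ∈-map⁻ (g ,_) p∈ | ∈-map⁻ (g ,_) q∈ | ∈-map⁻ (g ,_) r∈
    ... | _ , p∈X , refl | _ , q∈X , refl | _ , r∈X , refl =
      IsGPSet⇒¬InInterval gpX p∈X q∈X r∈X
        (p≢q ∘ cong (g ,_)) (p≢r ∘ cong (g ,_)) (q≢r ∘ cong (g ,_)) (InInterval-fibre⁻ between)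

-- Constant functions

module _ {VG VH : Set} {G : Graph VG} {H : Graph VH} {u : VH} where

  private GH = Sier G H (λ _ → u)

  baseʷ : ∀ {g g′ k} → Walk G g g′ k → Walk GH (g , u) (g′ , u) k
  baseʷ []      = []
  baseʷ (e ∷ w) = inj₂ (e , refl , refl) ∷ baseʷ w

  detour : ∀ {g h g′ h′ i k j} → Walk H h u i → Walk G g g′ k → Walk H u h′ j →
           Walk GH (g , h) (g′ , h′) (i + (k + j))
  detour v w v′ = fibreʷ v ++ʷ baseʷ w ++ʷ fibreʷ v′

  -- Every edge between fibres joins two copies of `u`. The parts before the first and after the
  -- last such edge are kept, while the closed walks at `u` in between are dropped, hence `≤ L`.
  same-fibre-or-detour : ∀ {g h g′ h′ L} → Walk GH (g , h) (g′ , h′) L →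
    (g ≡ g′ × Walk H h h′ L) ⊎
    (∃[ i ] ∃[ k ] ∃[ j ] Walk H h u i × Walk G g g′ k × Walk H u h′ j × i + (k + j) ≤ L)
  same-fibre-or-detour [] = inj₁ (refl , [])
  same-fibre-or-detour (e ∷ w) with same-fibre-or-detour w
  same-fibre-or-detour (inj₁ (refl , e) ∷ w) | inj₁ (refl , v) = inj₁ (refl , e ∷ v)
  same-fibre-or-detour (inj₂ (e , refl , refl) ∷ w) | inj₁ (refl , v) =
    inj₂ (0 , 1 , _ , [] , e ∷ [] , v , ≤-refl)
  same-fibre-or-detour (inj₁ (refl , e) ∷ w) | inj₂ (i , k , j , v , b , v′ , le) =
    inj₂ (suc i , k , j , e ∷ v , b , v′ , s≤s le)
  same-fibre-or-detour (inj₂ (e , refl , refl) ∷ w) | inj₂ (i , k , j , v , b , v′ , le) =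
    inj₂ (0 , suc k , j , [] , e ∷ b , v′ , s≤s (≤-trans (m≤n+m (k + j) i) le))

  -- The fibre of `g` can be left only through `(g , u)`, so a geodesic via `(g , q)` to another
  -- fibre begins with a geodesic from `p` via `q` to `u`.
  detour⇒InInterval : ∀ {g g′ p q r} → g ≢ g′ →
    InInterval GH (g , p) (g′ , r) (g , q) → InInterval H p u q
  detour⇒InInterval g≢g′ (_ , b , c , (_ , min) , pq , (qr , _) , refl)
    with same-fibre-or-detour qr
  ... | inj₁ (g≡g′ , _) = contradiction g≡g′ g≢g′
  ... | inj₂ (i , k , j , v , w , v′ , le) =
    geodesic⇒InInterval (proj₁ (Dist-fibre⁻ pq)) v λ m s →
      +-cancelʳ-≤ (k + j) (b + i) m (begin
        b + i + (k + j)   ≡⟨ +-assoc b i (k + j) ⟩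
        b + (i + (k + j)) ≤⟨ +-monoʳ-≤ b le ⟩
        b + c             ≤⟨ min _ (detour s w v′) ⟩
        m + (k + j)       ∎)
    where open ≤-Reasoning

  -- Visiting `(g₂ , q)` in transit is an excursion from `(g₂ , u)` and back; skipping it gives a
  -- strictly shorter walk. The case `g₁ ≡ g₃` is included.
  ¬InInterval-transit : ∀ {g₁ g₂ g₃ p q r} → g₁ ≢ g₂ → g₂ ≢ g₃ → q ≢ u →
                        ¬ InInterval GH (g₁ , p) (g₃ , r) (g₂ , q)
  ¬InInterval-transit g₁≢g₂ g₂≢g₃ q≢u (_ , b , c , (_ , min) , (pq , _) , (qr , _) , refl)
    with same-fibre-or-detour pq | same-fibre-or-detour qr
  ... | inj₁ (g₁≡g₂ , _) | _ = g₁≢g₂ g₁≡g₂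
  ... | inj₂ _ | inj₁ (g₂≡g₃ , _) = g₂≢g₃ g₂≡g₃
  ... | inj₂ _ | inj₂ (_ , _ , _ , [] , _) = q≢u refl
  -- The positive length `suc i′` of the way back from `q` to `u` makes the inequality strict.
  ... | inj₂ (i , k , j , v , w , _ , le) | inj₂ (suc i′ , k′ , j′ , _ ∷ _ , w′ , v′ , le′) =
    <-irrefl refl (begin-strict
      b + c                                       ≤⟨ min _ (detour v (w ++ʷ w′) v′) ⟩
      i + (k + k′ + j′)                           <⟨ ≤-reflexive (regroup i k k′ j′) ⟩
      i + k + (1 + (k′ + j′))                     ≤⟨ m≤m+n _ (j + i′) ⟩
      i + k + (1 + (k′ + j′)) + (j + i′)          ≡⟨ regroup′ i k j i′ k′ j′ ⟩
      (i + (k + j)) + (suc i′ + (k′ + j′))        ≤⟨ +-mono-≤ le le′ ⟩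
      b + c                                       ∎)
    where
    open ≤-Reasoning
    regroup : ∀ i k k′ j′ → suc (i + (k + k′ + j′)) ≡ i + k + (1 + (k′ + j′))
    regroup = solve-∀
    regroup′ : ∀ i k j i′ k′ j′ → i + k + (1 + (k′ + j′)) + (j + i′)
                                ≡ (i + (k + j)) + (suc i′ + (k′ + j′))
    regroup′ = solve-∀

  -- The cases are how many of the outer points share the fibre of the middle one: two contradict
  -- general position of `S`, one contradicts colinearity, none is the excursion excluded by
  -- `u ∉ S`.
  colinear⇒IsGPSet-product : ∀ {gs S} → (∀ (g g′ : VG) → Dec (g ≡ g′)) → Unique gs →
    IsColinear H u S → IsGPSet GH (cartesianProduct gs S)
  colinear⇒IsGPSet-product {gs} {S} _≟_ gs! (gpS , u∉S , colinear) =
    ¬InInterval⇒IsGPSet (Unique.cartesianProduct⁺ gs! (proj₁ gpS))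
      λ p∈ q∈ r∈ → separated (in-S p∈) (in-S q∈) (in-S r∈)
    where
    in-S : ∀ {p} → p ∈ cartesianProduct gs S → proj₂ p ∈ S
    in-S = proj₂ ∘ ∈-cartesianProduct⁻ gs S

    separated : ∀ {p q r} → proj₂ p ∈ S → proj₂ q ∈ S → proj₂ r ∈ S →
                p ≢ q → p ≢ r → q ≢ r → ¬ InInterval GH p r q
    separated {g₁ , p} {g₂ , q} {g₃ , r} p∈ q∈ r∈ p≢q p≢r q≢r between with g₁ ≟ g₂ | g₂ ≟ g₃
    ... | yes refl | yes refl =
      IsGPSet⇒¬InInterval gpS p∈ q∈ r∈ (p≢q ∘ cong (g₁ ,_)) (p≢r ∘ cong (g₁ ,_))
        (q≢r ∘ cong (g₁ ,_)) (InInterval-fibre⁻ between)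
    ... | yes refl | no g₂≢g₃ =
      colinear p q p∈ q∈ (p≢q ∘ cong (g₁ ,_)) (detour⇒InInterval g₂≢g₃ between)
    ... | no g₁≢g₂ | yes refl =
      colinear r q r∈ q∈ (q≢r ∘ cong (g₂ ,_) ∘ sym)
        (detour⇒InInterval (g₁≢g₂ ∘ sym) (InInterval-sym between))
    ... | no g₁≢g₂ | no g₂≢g₃ =
      ¬InInterval-transit g₁≢g₂ g₂≢g₃ (λ { refl → u∉S q∈ }) between

-- Counting by fibres

indicator : ∀ {n} → Fin n → Fin n → ℕ
indicator k g = if does (g Fin.≟ k) then 1 else 0

sum-indicator : ∀ {n} (k : Fin n) → sum (indicator k) ≡ 1
sum-indicator {suc n} zero    = cong suc (sum-replicate-zero n)
sum-indicator {suc n} (suc k) = sum-indicator k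

module _ {n : ℕ} {B : Set} where

  fibre : Fin n → List (Fin n × B) → List B
  fibre g X = map proj₂ (filter (λ p → g Fin.≟ proj₁ p) X)

  ∈-fibre⁻ : ∀ {g h} X → h ∈ fibre g X → (g , h) ∈ X
  ∈-fibre⁻ {g} X h∈ with ∈-map⁻ proj₂ h∈
  ... | p , p∈ , refl with ∈-filter⁻ (λ p → g Fin.≟ proj₁ p) {xs = X} p∈
  ... | p∈X , refl = p∈X

  Unique-fibre : ∀ g {X} → Unique X → Unique (fibre g X)
  Unique-fibre g [] = []
  Unique-fibre g {(g′ , h) ∷ X} (x∉ ∷ X!) with g Fin.≟ g′
  ... | no _     = Unique-fibre g X!
  ... | yes refl =
    All.tabulate (λ h′∈ → λ { refl → All.lookup x∉ (∈-fibre⁻ X h′∈) refl }) ∷ Unique-fibre g X!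

  length-fibre-∷ : ∀ g x X → length (fibre g (x ∷ X)) ≡ indicator (proj₁ x) g + length (fibre g X)
  length-fibre-∷ g x X with does (g Fin.≟ proj₁ x)
  ... | true  = refl
  ... | false = refl

  length≡sum-fibres : ∀ X → length X ≡ sum (λ g → length (fibre g X))
  length≡sum-fibres []      = sym (sum-replicate-zero n)
  length≡sum-fibres (x ∷ X) = begin
    suc (length X)
      ≡⟨ cong₂ _+_ (sym (sum-indicator (proj₁ x))) (length≡sum-fibres X) ⟩
    sum (indicator (proj₁ x)) + sum (λ g → length (fibre g X))
      ≡⟨ sym (∑-distrib-+ (indicator (proj₁ x)) (λ g → length (fibre g X))) ⟩
    sum (λ g → indicator (proj₁ x) g + length (fibre g X))
      ≡⟨ sum-cong-≗ (λ g → sym (length-fibre-∷ g x X)) ⟩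
    sum (λ g → length (fibre g (x ∷ X)))
      ∎
    where open ≡-Reasoning

sum-≤ : ∀ {n a} (t : Fin n → ℕ) → (∀ i → t i ≤ a) → sum t ≤ n * a
sum-≤ {zero}  t t≤a = z≤n
sum-≤ {suc n} t t≤a = +-mono-≤ (t≤a zero) (sum-≤ (t ∘ suc) (t≤a ∘ suc))

-- The other `n` terms contribute at most `n * a`, which leaves at least `a` for `t i`.
sum-≤-tight : ∀ {n a} (t : Fin n → ℕ) → (∀ i → t i ≤ a) → n * a ≤ sum t → ∀ i → a ≤ t i
sum-≤-tight {suc n} {a} t t≤a na≤sum i = +-cancelʳ-≤ (n * a) a (t i) (begin
  a + n * a                  ≤⟨ na≤sum ⟩
  sum t                      ≡⟨ sum-remove {i = i} t ⟩
  t i + sum (removeAt t i)   ≤⟨ +-monoʳ-≤ (t i) (sum-≤ (removeAt t i) (t≤a ∘ punchIn i)) ⟩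
  t i + n * a                ∎)
  where open ≤-Reasoning

length-cartesianProduct : ∀ {A B : Set} (xs : List A) (ys : List B) →
                          length (cartesianProduct xs ys) ≡ length xs * length ys
length-cartesianProduct []       ys = refl
length-cartesianProduct (x ∷ xs) ys =
  trans (length-++ (map (x ,_) ys))
        (cong₂ _+_ (length-map (x ,_) ys) (length-cartesianProduct xs ys))

module _ {nG : ℕ} {VH : Set} {G : Graph (Fin nG)} {H : Graph VH} {f : Fin nG → VH} where

  fibre-IsGPSet : ∀ {X} → IsGPSet (Sier G H f) X → ∀ g → IsGPSet H (fibre g X)
  fibre-IsGPSet {X} gpX g = ¬InInterval⇒IsGPSet (Unique-fibre g (proj₁ gpX))
    λ p∈ q∈ r∈ p≢q p≢r q≢r between →
      IsGPSet⇒¬InInterval gpX (∈-fibre⁻ X p∈) (∈-fibre⁻ X q∈) (∈-fibre⁻ X r∈)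
        (p≢q ∘ ,-injectiveʳ) (p≢r ∘ ,-injectiveʳ) (q≢r ∘ ,-injectiveʳ)
        (InInterval-fibre⁺ between)

  module _ {a} (gpH : IsGp H a) {X} (gpX : IsGPSet (Sier G H f) X) where

    length-fibre-≤ : ∀ g → length (fibre g X) ≤ a
    length-fibre-≤ g = proj₂ gpH _ (fibre g X , fibre-IsGPSet gpX g , refl)

    length-IsGPSet-≤ : length X ≤ nG * a
    length-IsGPSet-≤ =
      ≤-trans (≤-reflexive (length≡sum-fibres X))
              (sum-≤ (λ g → length (fibre g X)) length-fibre-≤)

    length-fibre-tight : nG * a ≤ length X → ∀ g → length (fibre g X) ≡ a
    length-fibre-tight na≤ g = ≤-antisym (length-fibre-≤ g)
      (sum-≤-tight (λ g → length (fibre g X)) length-fibre-≤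
        (≤-trans na≤ (≤-reflexive (length≡sum-fibres X))) g)

-- Colinear fibres

-- If `u` were in `S`, a second point `x` of `S` would violate separation, since `u` lies in the
-- interval from `x` to `u`.
separated⇒IsColinear : ∀ {n} {H : Graph (Fin n)} {u S} → (∀ x → ∃ (Dist H x u)) →
  IsGPSet H S → 2 ≤ length S →
  (∀ x y → x ∈ S → y ∈ S → x ≢ y → ¬ InInterval H x u y) → IsColinear H u S
separated⇒IsColinear {H = H} {u} dist gpS@(S! , _) 2≤S separated = gpS , u∉S , separated
  where
  another : ∀ {S} → Unique S → 2 ≤ length S → ∃[ x ] x ∈ S × x ≢ u
  another {x ∷ y ∷ _} ((x≢y ∷ _) ∷ _) _ with x Fin.≟ u
  ... | yes refl = y , there (here refl) , x≢y ∘ sym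
  ... | no x≢u   = x , here refl , x≢u
  another {_ ∷ []} _ (s≤s ())

  u∉S : u ∉ _
  u∉S u∈S with another S! 2≤S
  ... | x , x∈S , x≢u with dist x
  ... | k , w , min = separated x u x∈S u∈S x≢u
    (geodesic⇒InInterval w [] λ m v → ≤-trans (≤-reflexive (+-identityʳ k)) (min m v))

module _ {nG nH : ℕ} {G : Graph (Fin nG)} {H : Graph (Fin nH)} {f : Fin nG → Fin nH}
         (dist : ∀ x y → ∃ (Dist H x y)) where

  private
    d : Fin nH → Fin nH → ℕ
    d x y = proj₁ (dist x y)

    geodesic : ∀ x y → Walk H x y (d x y)
    geodesic x y = proj₁ (proj₂ (dist x y))

    d-min : ∀ {x y m} → Walk H x y m → d x y ≤ m
    d-min = proj₂ (proj₂ (dist _ _)) _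

  -- d(f g , z) − d(f g , f g₀), shifted by d(z , f g₀) so that the subtraction is exact.
  entry-cost : Fin nG → Fin nH → Fin nG → ℕ
  entry-cost g₀ z g = d (f g) z + d z (f g₀) ∸ d (f g) (f g₀)

  entry-cost-exact : ∀ g₀ z g →
    entry-cost g₀ z g + d (f g) (f g₀) ≡ d (f g) z + d z (f g₀)
  -- The triangle inequality through `z` prevents truncation.
  entry-cost-exact g₀ z g = m∸n+n≡m (d-min (geodesic (f g) z ++ʷ geodesic z (f g₀)))

  module _ {g₀ g : Fin nG} {z : Fin nH} (e : Adj G g₀ g)
           (cheapest : ∀ g′ → Adj G g₀ g′ → entry-cost g₀ z g ≤ entry-cost g₀ z g′) where

    -- The last entry comes from some neighbour `g′`. If the walk up to it keeps the roles of the
    -- pair, triangle inequalities suffice; if it exchanges them, minimality of the cost of `g` pays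
    -- for replacing `g′` by `g`.
    direct-entry-shortest : ∀ {x m} → Walk (Sier G H f) (g , x) (g₀ , z) m →
                            d x (f g₀) + suc (d (f g) z) ≤ m
    direct-entry-shortest {x} w with last-entry w
    ... | inj₁ (refl , _) = contradiction e (irrefl G)
    ... | inj₂ (g′ , l , k , e′ , v , s , refl) =
      ≤-trans (≤-reflexive (+-suc (d x (f g₀)) (d (f g) z))) (s≤s bound)
      where
      open ≤-Reasoning
      D = d z (f g₀)

      shuffle : ∀ i c a j → i + c + (a + j) ≡ i + j + (a + c)
      shuffle = solve-∀

      bound : d x (f g₀) + d (f g) z ≤ l + k
      bound with pair-walks v
      ... | inj₁ (i , j , p , q , i+j≤l) = begin
        d x (f g₀) + d (f g) z ≤⟨ +-mono-≤ (d-min p) (d-min (q ++ʷ s)) ⟩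
        i + (j + k)            ≡⟨ sym (+-assoc i j k) ⟩
        i + j + k              ≤⟨ +-monoˡ-≤ k i+j≤l ⟩
        l + k                  ∎
      -- Adding `D` to both sides matches the shift in `entry-cost`.
      ... | inj₂ (i , j , p , q , i+j≤l) = +-cancelʳ-≤ D _ _ (begin
        d x (f g₀) + d (f g) z + D
          ≡⟨ +-assoc (d x (f g₀)) _ D ⟩
        d x (f g₀) + (d (f g) z + D)
          ≡⟨ cong (d x (f g₀) +_) (sym (entry-cost-exact g₀ z g)) ⟩
        d x (f g₀) + (entry-cost g₀ z g + d (f g) (f g₀))
          ≤⟨ +-mono-≤ (d-min (p ++ʷ geodesic (f g′) (f g₀)))
                      (+-mono-≤ (cheapest g′ e′) (d-min q)) ⟩
        i + d (f g′) (f g₀) + (entry-cost g₀ z g′ + j)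
          ≡⟨ shuffle i _ _ j ⟩
        i + j + (entry-cost g₀ z g′ + d (f g′) (f g₀))
          ≡⟨ cong (i + j +_) (entry-cost-exact g₀ z g′) ⟩
        i + j + (d (f g′) z + D)
          ≤⟨ +-mono-≤ i+j≤l (+-monoˡ-≤ D (d-min s)) ⟩
        l + (k + D)
          ≡⟨ sym (+-assoc l k D) ⟩
        l + k + D
          ∎)

    -- For `y` between `x` and `f g₀`, a geodesic via `(g , y)` to `(g , f g₀)` extends over the
    -- direct edge to a geodesic ending at `(g₀ , z)`, and it carries three points of `X`.
    fibre-separated : ∀ {X} → IsGPSet (Sier G H f) X → (g₀ , z) ∈ X →
      ∀ x y → x ∈ fibre g X → y ∈ fibre g X → x ≢ y → ¬ InInterval H x (f g₀) y
    fibre-separated {X} gpX z∈ x y x∈ y∈ x≢y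
      (_ , b , c , (_ , min) , (w , _) , (v , _) , refl) =
      IsGPSet⇒¬InInterval gpX (∈-fibre⁻ X x∈) (∈-fibre⁻ X y∈) z∈
        (x≢y ∘ ,-injectiveʳ) (g≢g₀ ∘ ,-injectiveˡ) (g≢g₀ ∘ ,-injectiveˡ)
        (geodesic⇒InInterval (fibreʷ w)
          (fibreʷ v ++ʷ (inj₂ (adjSym G e , refl , refl) ∷ fibreʷ (geodesic (f g) z)))
          λ m s → begin
            b + (c + suc (d (f g) z))      ≡⟨ sym (+-assoc b c _) ⟩
            b + c + suc (d (f g) z)        ≤⟨ +-monoˡ-≤ _ (min _ (geodesic x (f g₀))) ⟩
            d x (f g₀) + suc (d (f g) z)   ≤⟨ direct-entry-shortest s ⟩
            m                              ∎)
      where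
      open ≤-Reasoning
      g≢g₀ : g ≢ g₀
      g≢g₀ refl = irrefl G e

-- The bounds and the case of equality

Colinear⇒IsXiAt : ∀ {V} {H : Graph V} {a u S} → IsGp H a → IsColinear H u S →
                  length S ≡ a → IsXiAt H u a
Colinear⇒IsXiAt (_ , max) colinear eq =
  -- Colinear sets are in general position, so one of size `a` is automatically largest.
  (_ , colinear , eq) , λ k (S , (gpS , _) , eq′) → max k (S , gpS , eq′)

IsXi≤IsGp : ∀ {V} {H : Graph V} {a x} → IsGp H a → IsXi H x → x ≤ a
IsXi≤IsGp (_ , max) ((_ , (S , (gpS , _) , eq) , _) , _) = max _ (S , gpS , eq)

2≤gp : ∀ {n a} {H : Graph (Fin n)} → 2 ≤ n → IsGp H a → 2 ≤ a
2≤gp {suc (suc n)} _ (_ , max) = max 2 (zero ∷ suc zero ∷ [] , pair-IsGPSet (λ ()) , refl)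
2≤gp {suc zero} (s≤s ())

neighbour : ∀ {n} {G : Graph (Fin n)} → 2 ≤ n → Connected G → ∃₂ (Adj G)
neighbour {suc (suc n)} _ conn with conn zero (suc zero)
-- A walk between distinct vertices has a first edge.
... | _ , e ∷ _ = _ , _ , e
neighbour {suc zero} (s≤s ())

nonempty⇒∈ : ∀ {A : Set} (xs : List A) → 1 ≤ length xs → ∃[ x ] x ∈ xs
nonempty⇒∈ (x ∷ _) _ = x , here refl

module _ {nG nH : ℕ} {G : Graph (Fin nG)} {H : Graph (Fin nH)}
         (2≤nG : 2 ≤ nG) (2≤nH : 2 ≤ nH) (connG : Connected G) (connH : Connected H) where

  gp≤gpSier : ∀ {a b f} → IsGp H a → IsGp (Sier G H f) b → a ≤ b
  gp≤gpSier {f = f} ((X , gpX , refl) , _) (_ , max) =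
    let (g , _) = neighbour {G = G} 2≤nG connG
    in max _ (map (g ,_) X , lift-IsGPSet g gpX , length-map (g ,_) X)

  gpSier≤ : ∀ {a c f} → IsGp H a → IsGp (Sier G H f) c → c ≤ nG * a
  gpSier≤ gpH ((X , gpX , refl) , _) = length-IsGPSet-≤ gpH gpX

  attained⇒≤ξ : ∀ {a x f} → IsGp H a → IsXi H x → IsGp (Sier G H f) (nG * a) → a ≤ x
  attained⇒≤ξ {a} {x} {f} gpH (_ , maxξ) ((X , gpX , |X|) , _) =
    -- The goal is decidable, hence stable under double negation, so distances in `H` and a cheapest
    -- neighbour `g` of `g₀` may be assumed.
    decidable-stable (a ≤? x) λ a≰x →
      ¬¬-distances H connH λ dist →
      ¬¬-argmin (Adj G g₀) (entry-cost {G = G} dist g₀ z) e λ (g , e , cheapest) →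
      a≰x (maxξ a (f g₀ , Colinear⇒IsXiAt gpH
        (separated⇒IsColinear (λ y → dist y (f g₀)) (fibre-IsGPSet gpX g)
          (subst (2 ≤_) (sym (|fibre| g)) 2≤a)
          (fibre-separated dist e cheapest gpX (∈-fibre⁻ X z∈)))
        (|fibre| g)))
    where
    2≤a = 2≤gp 2≤nH gpH
    |fibre| = length-fibre-tight gpH gpX (≤-reflexive (sym |X|))
    edge = neighbour {G = G} 2≤nG connG
    g₀ = proj₁ edge
    e = proj₂ (proj₂ edge)
    point = nonempty⇒∈ (fibre g₀ X) (subst (1 ≤_) (sym (|fibre| g₀)) (≤-trans (n≤1+n 1) 2≤a))
    z = proj₁ point
    z∈ = proj₂ point

  ξ≡gp⇒attained : ∀ {a} → IsGp H a → IsXi H a → ∃[ f ] IsGp (Sier G H f) (nG * a)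
  ξ≡gp⇒attained gpH ((u , (S , colinear , refl) , _) , _) =
    (λ _ → u) ,
    (cartesianProduct (allFin nG) S ,
     colinear⇒IsGPSet-product Fin._≟_ (Unique.allFin⁺ nG) colinear ,
     trans (length-cartesianProduct (allFin nG) S)
           (cong (_* length S) (length-tabulate {n = nG} (λ i → i)))) ,
    λ { k (X , gpX , refl) → length-IsGPSet-≤ gpH gpX }

theorem4p2 : ∀ {nG nH : ℕ} (G : Graph (Fin nG)) (H : Graph (Fin nH)) →
    2 ≤ nG → 2 ≤ nH → Connected G → Connected H →
    ∀ {a b c x : ℕ} →
    IsGp H a → IsGpSLow G H b → IsGpS G H c → IsXi H x →
    (a ≤ b × b ≤ c × c ≤ nG * a) × ((c ≡ nG * a) ⇔ (a ≡ x))
theorem4p2 G H 2≤nG 2≤nH connG connH gpH ((f₁ , gp₁) , _) ((f₂ , gp₂) , maxS) ξH =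
  (gp≤gpSier 2≤nG 2≤nH connG connH gpH gp₁ , maxS _ (f₁ , gp₁) , c≤) ,
  -- In the first direction `f₂` attains the upper bound, which gives `a ≤ x`; the reverse
  -- inequality always holds.
  mk⇔ (λ { refl → ≤-antisym (attained⇒≤ξ 2≤nG 2≤nH connG connH gpH ξH gp₂) (IsXi≤IsGp gpH ξH) })
      (λ { refl → ≤-antisym c≤ (maxS _ (ξ≡gp⇒attained 2≤nG 2≤nH connG connH gpH ξH)) })
  where
  c≤ = gpSier≤ 2≤nG 2≤nH connG connH gpH gp₂
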